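{- For every future-finite-universal order $(F,\leq_F)$, the subset order $(P_{\mathrm{fin}}(F),\leq^{\mathrm{dom}}_F)$ is universal.
   Context: "Order" means partial order. A countable order is future-finite if for every element $x$ the up-set $\{y: x\leq y\}$ is finite. An order $(P,\leq_P)$ is a suborder of $(Q,\leq_Q)$ if there is an order embedding, i.e. a map $E:P\to Q$ with $a\leq_P b\iff E(a)\leq_Q E(b)$. A countable order is future-finite-universal if it contains every future-finite order as a suborder, and universal if it contains every countable order as a suborder. $P_{\mathrm{fin}}(F)$ is the set of finite subsets of $F$, and for $A,B\in P_{\mathrm{fin}}(F)$, $A\leq^{\mathrm{dom}}_F B$ iff for every $a\in A$ there is $b\in B$ with $a\leq_F b$. This is a quasi-order; it is regarded as an order by choosing one representative of each equivalence class (namely the finite antichains of $F$). -}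

module Defs where

open import Data.List.Base using (List)
import Data.List.Membership.Setoid as Membership
import Data.List.Membership.Setoid.Properties as Membershipₚ
import Data.List.Relation.Binary.Subset.Setoid as Subset
open import Data.Nat.Base using (ℕ)
open import Data.Product.Base using (Σ; ∃; _×_; _,_; proj₁; proj₂; swap)
open import Function.Base using (id; _∘_; _on_)
open import Function.Bundles using (Injection; _⇔_)
open import Level using (Level; suc)
open import Relation.Binary.Bundles using (Poset; Setoid)
open import Relation.Binary.Core using (Rel)
import Relation.Binary.PropositionalEquality as ≡
open import Relation.Unary using (Pred)

-- An order is a `Poset`; its elements are identified along `_≈_`.
Order : (ℓ : Level) → Set (suc ℓ)
Order ℓ = Poset ℓ ℓ ℓ

-- Finite or countably infinite.
Countable : ∀ {ℓ} → Setoid ℓ ℓ → Set ℓ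
Countable S = Injection S (≡.setoid ℕ)

Finite : ∀ {ℓ} (S : Setoid ℓ ℓ) → Pred (Setoid.Carrier S) ℓ → Set ℓ
Finite S U = ∃ λ xs → ∀ y → U y ⇔ y ∈ xs
  where open Membership S using (_∈_)

CountableOrder : ∀ {ℓ} → Order ℓ → Set ℓ
CountableOrder P = Countable (Poset.Eq.setoid P)

FutureFinite : ∀ {ℓ} → Order ℓ → Set ℓ
FutureFinite P = CountableOrder P × (∀ x → Finite Eq.setoid (λ y → x ≤ y))
  where open Poset P

infix 4 _IsSuborderOf_

-- Such an E automatically respects and reflects `_≈_`, by reflexivity and
-- antisymmetry.
_IsSuborderOf_ : ∀ {ℓ} → Order ℓ → Order ℓ → Set ℓ
P IsSuborderOf Q = Σ (P.Carrier → Q.Carrier) λ E → ∀ a b → a P.≤ b ⇔ E a Q.≤ E b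
  where
  module P = Poset P
  module Q = Poset Q

FutureFiniteUniversal : ∀ {ℓ} → Order ℓ → Set (suc ℓ)
FutureFiniteUniversal {ℓ} F =
  CountableOrder F × ((P : Order ℓ) → FutureFinite P → P IsSuborderOf F)

Universal : ∀ {ℓ} → Order ℓ → Set (suc ℓ)
Universal {ℓ} Q =
  CountableOrder Q × ((P : Order ℓ) → CountableOrder P → P IsSuborderOf Q)

module _ {ℓ} (F : Order ℓ) where

  open Poset F
  open Membership Eq.setoid using (_∈_)
  open Membershipₚ using (∈-resp-≈)
  open Subset Eq.setoid using (_⊆_)

  -- A finite subset is a list of its elements; order and repetitions are
  -- disregarded by `SameElements`.
  FiniteSubset : Set ℓ
  FiniteSubset = List Carrier

  SameElements : Rel FiniteSubset ℓ
  SameElements A B = A ⊆ B × B ⊆ A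

  Dom : Rel FiniteSubset ℓ
  Dom A B = ∀ {a} → a ∈ A → ∃ λ b → b ∈ B × a ≤ b

  IsAntichain : Pred FiniteSubset ℓ
  IsAntichain A = ∀ {a b} → a ∈ A → b ∈ A → a ≤ b → a ≈ b

  FiniteAntichain : Set ℓ
  FiniteAntichain = Σ FiniteSubset IsAntichain

  ⊆⇒Dom : ∀ {A B} → A ⊆ B → Dom A B
  ⊆⇒Dom A⊆B a∈A = _ , A⊆B a∈A , refl

  Dom-trans : ∀ {A B C} → Dom A B → Dom B C → Dom A C
  Dom-trans A≤B B≤C a∈A =
    let b , b∈B , a≤b = A≤B a∈A
        c , c∈C , b≤c = B≤C b∈B
    in c , c∈C , trans a≤b b≤c

  antichain-⊆ : ∀ {A B} → IsAntichain A → Dom A B → Dom B A → A ⊆ B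
  antichain-⊆ anti A≤B B≤A a∈A =
    let b , b∈B , a≤b   = A≤B a∈A
        a′ , a′∈A , b≤a′ = B≤A b∈B
        a≈a′ = anti a∈A a′∈A (trans a≤b b≤a′)
        b≤a  = trans b≤a′ (reflexive (Eq.sym a≈a′))
    in ∈-resp-≈ Eq.setoid (antisym b≤a a≤b) b∈B

  -- The subset order.  `Dom` is only a quasi-order on finite subsets; the
  -- finite antichains represent the classes of mutual domination.
  SubsetOrder : Order ℓ
  SubsetOrder = record
    { Carrier        = FiniteAntichain
    ; _≈_            = SameElements on proj₁
    ; _≤_            = Dom on proj₁
    ; isPartialOrder = record
      { isPreorder = record
        { isEquivalence = record
          { refl  = id , id
          ; sym   = swap
          ; trans = λ (A⊆B , B⊆A) (B⊆C , C⊆B) → B⊆C ∘ A⊆B , B⊆A ∘ C⊆B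
          }
        ; reflexive = λ (A⊆B , _) → ⊆⇒Dom A⊆B
        ; trans     = Dom-trans
        }
      ; antisym = λ {(_ , antiA)} {(_ , antiB)} A≤B B≤A →
          antichain-⊆ antiA A≤B B≤A , antichain-⊆ antiB B≤A A≤B
      }
    }

{-# OPTIONS --safe #-}

-- Countability of P gives an index |x| ∈ ℕ to every element.  Let Q be P with
-- the order x ≤ y ∧ |y| ≤ |x|: only finitely many indices lie below |x|, so Q
-- is future-finite and embeds into F.  Send x to A x = {z : z ≤ x, |z| ≤ |x|}.
-- If x ≤ y and z ∈ A x, then z ∈ A y when |z| ≤ |y|, and otherwise z lies below
-- y ∈ A y in Q.  Conversely, if A y dominates A x in Q, then x ≤ z ≤ y for
-- some z ∈ A y.  It remains to replace the image of A x in F by its maximal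
-- elements.
module Submission where

open import Defs
open import Axiom.ExcludedMiddle using (ExcludedMiddle)
open import Data.Bool.Base using (Bool; true; false)
open import Data.List.Base using (List; []; _∷_; map; filter)
open import Data.List.Extrema.Nat using (max; xs≤max)
import Data.List.Membership.Setoid as Membership
import Data.List.Membership.Setoid.Properties as Membershipₚ
open import Data.List.Relation.Binary.Subset.Propositional using (_⊆_)
import Data.List.Relation.Binary.Subset.Setoid as Subset
import Data.List.Relation.Unary.All as All
open import Data.List.Relation.Unary.Any using (here; there)
open import Data.Nat.Base using (ℕ; zero; suc; _+_; _*_; _≤_; _<_; s≤s)
open import Data.Nat.Properties using
  ( _≟_; suc-injective; *-cancelˡ-≡; even≢odd; +-comm; m≤n+m; m≤m+n; ≤-refl; ≤-trans
  ; ≤-reflexive; ≤-total; <⇒≱; m≤n⇒m<n∨m≡n )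
open import Data.List.Membership.DecPropositional _≟_ using (_∈_; _∈?_)
open import Data.Product.Base using (∃; _×_; _,_; proj₁; proj₂)
open import Data.Sum.Base using (inj₁; inj₂)
open import Function.Base using (_∘_)
open import Function.Construct.Composition using (_⇔-∘_)
open import Function.Bundles using (Injection; Equivalence; _⇔_; mk⇔)
open import Relation.Binary.Bundles using (Poset; Setoid)
open import Relation.Binary.Definitions using (_Respects_)
open import Relation.Binary.PropositionalEquality
  using (_≡_; refl; sym; trans; cong; cong₂; subst; module ≡-Reasoning)
  renaming (setoid to ≡-setoid)
open import Relation.Nullary.Decidable using (Dec; yes; no; does; does-⇔; dec-true; dec-false)
open import Relation.Nullary.Negation using (¬_; contradiction)
open import Relation.Unary using (Pred)

open Equivalence using (to; from)

-- Coding finite sets of naturals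

-- A finite set of naturals is coded by the binary numeral of its indicator
-- function, read up to any bound: leading zeros do not change the value.

bit : Bool → ℕ → ℕ
bit false m = 2 * m
bit true  m = suc (2 * m)

-- Parity recovers the bit, and halving recovers the remaining numeral.
bit-injective : ∀ a b {m n} → bit a m ≡ bit b n → a ≡ b × m ≡ n
bit-injective false false {m} {n} eq = refl , *-cancelˡ-≡ m n 2 eq
bit-injective true  true  {m} {n} eq = refl , *-cancelˡ-≡ m n 2 (suc-injective eq)
bit-injective false true  {m} {n} eq = contradiction eq (even≢odd m n)
bit-injective true  false {m} {n} eq = contradiction (sym eq) (even≢odd n m)

binary : (ℕ → Bool) → ℕ → ℕ
binary χ zero    = 0
binary χ (suc n) = bit (χ 0) (binary (χ ∘ suc) n)

binary-cong : ∀ {χ ψ} → (∀ i → χ i ≡ ψ i) → ∀ n → binary χ n ≡ binary ψ n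
binary-cong χ≗ψ zero    = refl
binary-cong χ≗ψ (suc n) = cong₂ bit (χ≗ψ 0) (binary-cong (χ≗ψ ∘ suc) n)

binary-injective : ∀ {χ ψ} n → binary χ n ≡ binary ψ n → ∀ {i} → i < n → χ i ≡ ψ i
binary-injective {χ} {ψ} (suc n) eq {zero}  _         = proj₁ (bit-injective (χ 0) (ψ 0) eq)
binary-injective {χ} {ψ} (suc n) eq {suc i} (s≤s i<n) =
  binary-injective n (proj₂ (bit-injective (χ 0) (ψ 0) eq)) i<n

-- `binary` consumes digits from the lowest up, so the top digit is reached only by induction; there
-- the numeral is `bit false 0`, which is 0.
binary-leading-false : ∀ {χ} n → χ n ≡ false → binary χ (suc n) ≡ binary χ n
binary-leading-false     zero    χ0≡f = cong (λ b → bit b 0) χ0≡f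
binary-leading-false {χ} (suc n) χn≡f = cong (bit (χ 0)) (binary-leading-false n χn≡f)

binary-extend : ∀ {χ n} → (∀ {i} → n ≤ i → χ i ≡ false) → ∀ k → binary χ (k + n) ≡ binary χ n
binary-extend         χ≡f zero    = refl
binary-extend {n = n} χ≡f (suc k) =
  trans (binary-leading-false (k + n) (χ≡f (m≤n+m n k))) (binary-extend χ≡f k)

indicator : List ℕ → ℕ → Bool
indicator xs i = does (i ∈? xs)

-- The `suc` makes the bound strict, since `binary χ n` reads only the digits below `n`. The default
-- 0 serves the empty list, whose numeral is then a single zero digit.
bound : List ℕ → ℕ
bound xs = suc (max 0 xs)

∈⇒<bound : ∀ {i xs} → i ∈ xs → i < bound xs
∈⇒<bound {xs = xs} i∈xs = s≤s (All.lookup (xs≤max 0 xs) i∈xs)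

setCode : List ℕ → ℕ
setCode xs = binary (indicator xs) (bound xs)

-- Two lists may have different bounds. This lets both numerals be read up to the sum of the bounds,
-- where they can be compared digit by digit.
setCode-extend : ∀ xs k → binary (indicator xs) (k + bound xs) ≡ setCode xs
setCode-extend xs = binary-extend λ {i} b≤i →
  dec-false (i ∈? xs) λ i∈xs → <⇒≱ (∈⇒<bound i∈xs) b≤i

setCode-extend′ : ∀ xs k → binary (indicator xs) (bound xs + k) ≡ setCode xs
setCode-extend′ xs k =
  trans (cong (binary (indicator xs)) (+-comm (bound xs) k)) (setCode-extend xs k)

setCode-cong : ∀ {xs ys} → xs ⊆ ys → ys ⊆ xs → setCode xs ≡ setCode ys
setCode-cong {xs} {ys} xs⊆ys ys⊆xs = begin
  setCode xs                                  ≡⟨ setCode-extend′ xs (bound ys) ⟨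
  binary (indicator xs) (bound xs + bound ys) ≡⟨ binary-cong same (bound xs + bound ys) ⟩
  binary (indicator ys) (bound xs + bound ys) ≡⟨ setCode-extend ys (bound xs) ⟩
  setCode ys                                  ∎
  where
  open ≡-Reasoning
  same : ∀ i → indicator xs i ≡ indicator ys i
  same i = does-⇔ (mk⇔ xs⊆ys ys⊆xs) (i ∈? xs) (i ∈? ys)

-- At the common length the numerals agree, hence so do their digits. A member `i` of `xs` lies
-- below `bound xs`, so its digit is among those read.
setCode-injective : ∀ {xs ys} → setCode xs ≡ setCode ys → xs ⊆ ys
setCode-injective {xs} {ys} eq {i} i∈xs with i ∈? ys in i∈?ys≡
... | yes i∈ys = i∈ys
-- The digit at `i` would be `true` for `xs` and `false` for `ys`.
... | no  _    = contradiction
  (trans (sym (dec-true (i ∈? xs) i∈xs)) (trans same (cong does i∈?ys≡))) λ ()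
  where
  same : indicator xs i ≡ indicator ys i
  same = binary-injective {indicator xs} {indicator ys} (bound xs + bound ys)
    (trans (setCode-extend′ xs (bound ys)) (trans eq (sym (setCode-extend ys (bound xs)))))
    (≤-trans (∈⇒<bound i∈xs) (m≤m+n (bound xs) (bound ys)))

-- Countability of the subset order

module _ {ℓ} (F : Order ℓ) (countable : CountableOrder F) where

  private
    module F = Poset F
    module I = Injection countable
    open Subset F.Eq.setoid using () renaming (_⊆_ to _⊆F_)

    code : List F.Carrier → ℕ
    code = setCode ∘ map I.to

    map-⊆ : ∀ {A B} → A ⊆F B → map I.to A ⊆ map I.to B
    map-⊆ A⊆B i∈ =
      let a , a∈A , i≡ = Membershipₚ.∈-map⁻ F.Eq.setoid (≡-setoid ℕ) i∈
      in subst (_∈ _) (sym i≡) (Membershipₚ.∈-map⁺ F.Eq.setoid (≡-setoid ℕ) I.cong (A⊆B a∈A))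

    map-⊆⁻ : ∀ {A B} → map I.to A ⊆ map I.to B → A ⊆F B
    map-⊆⁻ mA⊆mB a∈A =
      let b , b∈B , fa≡fb = Membershipₚ.∈-map⁻ F.Eq.setoid (≡-setoid ℕ)
                              (mA⊆mB (Membershipₚ.∈-map⁺ F.Eq.setoid (≡-setoid ℕ) I.cong a∈A))
      in Membershipₚ.∈-resp-≈ F.Eq.setoid (F.Eq.sym (I.injective fa≡fb)) b∈B

  subsetOrder-countable : CountableOrder (SubsetOrder F)
  subsetOrder-countable = record
    { to        = code ∘ proj₁
    ; cong      = λ (A⊆B , B⊆A) → setCode-cong (map-⊆ A⊆B) (map-⊆ B⊆A)
    ; injective = λ eq → map-⊆⁻ (setCode-injective eq) , map-⊆⁻ (setCode-injective (sym eq))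
    }

-- Finiteness from bounded indices

module _ {ℓ} (em : ExcludedMiddle ℓ) where

  -- Induction on the bound: the index is injective, so raising the bound by one admits at most one
  -- new element, and excluded middle decides whether there is one.
  bounded⇒finite : (S : Setoid ℓ ℓ) (countable : Countable S) →
    (U : Pred (Setoid.Carrier S) ℓ) → U Respects Setoid._≈_ S →
    ∀ n → (∀ {y} → U y → Injection.to countable y < n) → Finite S U
  bounded⇒finite S countable U resp zero U<n =
    [] , λ y → mk⇔ (λ Uy → contradiction (U<n Uy) λ ()) λ ()
  bounded⇒finite S countable U resp (suc n) U<1+n
    with ys , ys-spec ← bounded⇒finite S countable (λ y → U y × Injection.to countable y < n)
           (λ y≈z (Uy , y<n) → resp y≈z Uy , subst (_< n) (Injection.cong countable y≈z) y<n)
           n proj₂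
    with em {∃ λ x → U x × Injection.to countable x ≡ n}
  ... | yes (x , Ux , x≡n) = x ∷ ys , λ y → mk⇔ (into y)
          λ { (here y≈x) → resp (Setoid.sym S y≈x) Ux
            ; (there y∈ys) → proj₁ (from (ys-spec y) y∈ys) }
    where
    into : ∀ y → U y → Membership._∈_ S y (x ∷ ys)
    into y Uy with m≤n⇒m<n∨m≡n (U<1+n Uy)
    ... | inj₁ (s≤s y<n) = there (to (ys-spec y) (Uy , y<n))
    ... | inj₂ 1+y≡1+n =
      here (Injection.injective countable (trans (suc-injective 1+y≡1+n) (sym x≡n)))
  ... | no ∄x = ys , λ y → mk⇔ (into y) (proj₁ ∘ from (ys-spec y))
    where
    into : ∀ y → U y → Membership._∈_ S y ys
    into y Uy with m≤n⇒m<n∨m≡n (U<1+n Uy)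
    ... | inj₁ (s≤s y<n) = to (ys-spec y) (Uy , y<n)
    ... | inj₂ 1+y≡1+n   = contradiction (y , Uy , suc-injective 1+y≡1+n) ∄x

  -- Maximal elements of a finite subset

  module _ (F : Order ℓ) where

    open Poset F using (Carrier; _≈_; module Eq) renaming
      (_≤_ to _⊑_; trans to ⊑-trans; reflexive to ⊑-reflexive)
    open Membership Eq.setoid using () renaming (_∈_ to _∈F_)
    open Subset Eq.setoid using () renaming (_⊆_ to _⊆F_)

    -- Elements are inserted one at a time. A new `x` below a kept element is dropped; otherwise it
    -- joins and expels every kept element below it.
    maximalElements : ∀ A → ∃ λ M → IsAntichain F M × M ⊆F A × Dom F A M
    maximalElements [] = [] , (λ ()) , (λ ()) , (λ ())
    maximalElements (x ∷ A) with M , anti , M⊆A , A≤M ← maximalElements A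
                            with em {∃ λ m → m ∈F M × x ⊑ m}
    ... | yes (m , m∈M , x⊑m) = M , anti , there ∘ M⊆A ,
      λ { (here a≈x)  → m , m∈M , ⊑-trans (⊑-reflexive a≈x) x⊑m
        ; (there a∈A) → A≤M a∈A }
    ... | no x⋢M = x ∷ M′ , anti′ ,
      (λ { (here a≈x) → here a≈x ; (there a∈M′) → there (M⊆A (proj₁ (M′⁻ a∈M′))) }) ,
      (λ { (here a≈x) → x , here Eq.refl , ⊑-reflexive a≈x ; (there a∈A) → dom a∈A })
      where
      ⋢x? : ∀ m → Dec (¬ m ⊑ x)
      ⋢x? m = em
      M′ = filter ⋢x? M
      resp : (λ m → ¬ m ⊑ x) Respects _≈_
      resp a≈b a⋢x b⊑x = a⋢x (⊑-trans (⊑-reflexive a≈b) b⊑x)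
      M′⁻ : ∀ {a} → a ∈F M′ → a ∈F M × ¬ a ⊑ x
      M′⁻ = Membershipₚ.∈-filter⁻ Eq.setoid ⋢x? resp
      anti′ : IsAntichain F (x ∷ M′)
      anti′ (here a≈x)   (here b≈x)   _   = Eq.trans a≈x (Eq.sym b≈x)
      anti′ (here a≈x)   (there b∈M′) a⊑b =
        contradiction (_ , proj₁ (M′⁻ b∈M′) , ⊑-trans (⊑-reflexive (Eq.sym a≈x)) a⊑b) x⋢M
      anti′ (there a∈M′) (here b≈x)   a⊑b =
        contradiction (⊑-trans a⊑b (⊑-reflexive b≈x)) (proj₂ (M′⁻ a∈M′))
      anti′ (there a∈M′) (there b∈M′) a⊑b = anti (proj₁ (M′⁻ a∈M′)) (proj₁ (M′⁻ b∈M′)) a⊑b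
      dom : ∀ {a} → a ∈F A → ∃ λ b → b ∈F (x ∷ M′) × a ⊑ b
      -- If the kept `m` above `a` is expelled, then `x` lies above `m` and replaces it as witness.
      dom a∈A with m , m∈M , a⊑m ← A≤M a∈A with em {m ⊑ x}
      ... | yes m⊑x = x , here Eq.refl , ⊑-trans a⊑m m⊑x
      ... | no  m⋢x = m , there (Membershipₚ.∈-filter⁺ Eq.setoid ⋢x? resp m∈M m⋢x) , a⊑m

    antichainOf : List Carrier → FiniteAntichain F
    antichainOf A = let M , anti , _ = maximalElements A in M , anti

    -- A list and its maximal elements dominate each other, so transitivity gives both directions.
    Dom-antichainOf : ∀ A B →
      Dom F A B ⇔ Dom F (proj₁ (antichainOf A)) (proj₁ (antichainOf B))
    Dom-antichainOf A B with maximalElements A | maximalElements B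
    ... | M , _ , M⊆A , A≤M | N , _ , N⊆B , B≤N = mk⇔ forth back
      where
      forth : Dom F A B → Dom F M N
      forth A≤B = Dom-trans F (⊆⇒Dom F M⊆A) (Dom-trans F A≤B B≤N)
      back : Dom F M N → Dom F A B
      back M≤N = Dom-trans F A≤M (Dom-trans F M≤N (⊆⇒Dom F N⊆B))

  -- The future-finite order on a countable order

  module _ (P : Order ℓ) (countable : CountableOrder P) where

    private
      module P = Poset P
      open Injection countable using () renaming
        (to to index; cong to index-cong)

    indexReversed : Order ℓ
    indexReversed = record
      { Carrier        = P.Carrier
      ; _≈_            = P._≈_
      ; _≤_            = λ x y → x P.≤ y × index y ≤ index x
      ; isPartialOrder = record
        { isPreorder = record
          { isEquivalence = P.isEquivalence
          ; reflexive     = λ x≈y → P.reflexive x≈y , ≤-reflexive (sym (index-cong x≈y))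
          ; trans         = λ (x≤y , ∣y∣≤∣x∣) (y≤z , ∣z∣≤∣y∣) →
              P.trans x≤y y≤z , ≤-trans ∣z∣≤∣y∣ ∣y∣≤∣x∣
          }
        ; antisym = λ (x≤y , _) (y≤x , _) → P.antisym x≤y y≤x
        }
      }

    private
      module Q = Poset indexReversed

    -- Going up in this order never increases the index, so everything above `x` has index below
    -- `suc (index x)`.
    indexReversed-futureFinite : FutureFinite indexReversed
    indexReversed-futureFinite = countable , λ x →
      bounded⇒finite Q.Eq.setoid countable (x Q.≤_)
        (λ y≈z x≤y → Q.trans x≤y (Q.reflexive y≈z)) (suc (index x)) (s≤s ∘ proj₂)

    -- The set `A x` of the overview. It contains `x` itself, which both directions of
    -- `Dom-earlierBelow` use.
    earlierBelow : ∀ x → Finite P.Eq.setoid (λ z → z P.≤ x × index z ≤ index x)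
    earlierBelow x = bounded⇒finite P.Eq.setoid countable _
      (λ y≈z (y≤x , ∣y∣≤∣x∣) → P.trans (P.reflexive (P.Eq.sym y≈z)) y≤x ,
                              subst (_≤ index x) (index-cong y≈z) ∣y∣≤∣x∣)
      (suc (index x)) (s≤s ∘ proj₂)

    Dom-earlierBelow : ∀ x y →
      x P.≤ y ⇔ Dom indexReversed (proj₁ (earlierBelow x)) (proj₁ (earlierBelow y))
    Dom-earlierBelow x y with earlierBelow x | earlierBelow y
    ... | A , A-spec | B , B-spec = mk⇔ dominated below
      where
      below : Dom indexReversed A B → x P.≤ y
      below A≤B =
        let z , z∈B , x≤z , _ = A≤B (to (A-spec x) (P.refl , ≤-refl))
        in P.trans x≤z (proj₁ (from (B-spec z) z∈B))
      dominated : x P.≤ y → Dom indexReversed A B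
      -- Nothing relates the indices of `x` and `y`, so `z` may come before or after `y`: in the
      -- first case it dominates itself, in the second `y` dominates it.
      dominated x≤y {z} z∈A with z≤x , _ ← from (A-spec z) z∈A
                            with ≤-total (index z) (index y)
      ... | inj₁ ∣z∣≤∣y∣ = z , to (B-spec z) (P.trans z≤x x≤y , ∣z∣≤∣y∣) , Q.refl
      ... | inj₂ ∣y∣≤∣z∣ = y , to (B-spec y) (P.refl , ≤-refl) , P.trans z≤x x≤y , ∣y∣≤∣z∣

-- Transporting domination along an embedding

module _ {ℓ} (Q F : Order ℓ) (suborder : Q IsSuborderOf F) where

  private
    module Q = Poset Q
    module F = Poset F
    E = proj₁ suborder
    E-≤ = proj₂ suborder

    E-cong : ∀ {x y} → x Q.≈ y → E x F.≈ E y
    E-cong x≈y = F.antisym (to (E-≤ _ _) (Q.reflexive x≈y))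
                           (to (E-≤ _ _) (Q.reflexive (Q.Eq.sym x≈y)))

  -- Stated for arbitrary lists, because the sets `A x` need not be antichains in `Q`. Forward uses
  -- that `E` preserves the order, backward that it reflects it.
  Dom-map : ∀ A B → Dom Q A B ⇔ Dom F (map E A) (map E B)
  Dom-map A B = mk⇔ forth back
    where
    forth : Dom Q A B → Dom F (map E A) (map E B)
    forth A≤B a∈ =
      let x , x∈A , a≈Ex = Membershipₚ.∈-map⁻ Q.Eq.setoid F.Eq.setoid a∈
          y , y∈B , x≤y  = A≤B x∈A
      in E y , Membershipₚ.∈-map⁺ Q.Eq.setoid F.Eq.setoid E-cong y∈B ,
         F.trans (F.reflexive a≈Ex) (to (E-≤ x y) x≤y)
    back : Dom F (map E A) (map E B) → Dom Q A B
    back EA≤EB {x} x∈A =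
      let b , b∈ , Ex≤b  = EA≤EB (Membershipₚ.∈-map⁺ Q.Eq.setoid F.Eq.setoid E-cong x∈A)
          y , y∈B , b≈Ey = Membershipₚ.∈-map⁻ Q.Eq.setoid F.Eq.setoid b∈
      in y , y∈B , from (E-≤ x y) (F.trans Ex≤b (F.reflexive b≈Ey))

theorem5p1p5 : ∀ {ℓ} → ExcludedMiddle ℓ →
    (F : Order ℓ) → FutureFiniteUniversal F → Universal (SubsetOrder F)
theorem5p1p5 em F (countableF , universalF) = subsetOrder-countable F countableF , embed
  where
  embed : ∀ P → CountableOrder P → P IsSuborderOf SubsetOrder F
  embed P countableP =
    (λ x → antichainOf em F (map (proj₁ suborder) (A x))) , λ x y →
      -- Read from right to left: the order of `P` becomes domination in `Q`, then domination of the
      -- images in `F`, then domination of their maximal elements.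
      Dom-antichainOf em F _ _ ⇔-∘
        (Dom-map Q F suborder (A x) (A y) ⇔-∘ Dom-earlierBelow em P countableP x y)
    where
    Q = indexReversed em P countableP
    suborder = universalF Q (indexReversed-futureFinite em P countableP)
    A = λ x → proj₁ (earlierBelow em P countableP x)
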